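{- There is an algorithm that, given a positive integer $n$, tests whether $n$ is sturdy (in base $2$) in $O(n)$ steps.
   Context: For a non-negative integer $m$, $s_2(m)$ denotes the sum of the binary digits of $m$. A positive integer $n$ is flimsy (in base $2$) if there exists a positive integer $k$ with $s_2(kn) < s_2(n)$; otherwise $n$ is sturdy. Running time is measured as the number of RAM operations on integers of size about $n$ (i.e. on words of $O(\log n)$ bits). -}

module Defs where

open import Data.Bool.Base using (Bool; if_then_else_)
open import Data.Digit using (toDigits)
open import Data.Fin.Base using (Fin; toℕ)
open import Data.List.Base using (List; head; drop; map)
open import Data.Maybe.Base using (Maybe; just; nothing)
open import Data.Nat.Base using (ℕ; suc; _+_; _*_; _∸_; _^_; _≤_; _<_; _≡ᵇ_)
open import Data.Nat.GeneralisedArithmetic using (iterate)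
open import Data.Nat.ListAction using (sum)
open import Data.Nat.Logarithm using (⌊log₂_⌋)
open import Data.Product.Base using (∃-syntax; _×_; proj₁)
open import Data.Unit.Base using (⊤)
open import Data.Vec.Base using (Vec; _∷_; replicate; lookup; _[_]≔_)
open import Data.Vec.Relation.Unary.All using (All)
open import Relation.Binary.PropositionalEquality.Core using (_≡_)
open import Relation.Nullary.Negation.Core using (¬_)
open import Relation.Nullary.Reflects using (Reflects)

s₂ : ℕ → ℕ
s₂ m = sum (map toℕ (proj₁ (toDigits 2 m)))

Flimsy : ℕ → Set
Flimsy n = ∃[ k ] 0 < k × s₂ (k * n) < s₂ n

Sturdy : ℕ → Set
Sturdy n = ¬ Flimsy n

-- A machine has finitely many registers and a memory indexed by ℕ, all
-- holding natural numbers.  The word length is not built into the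
-- transitions: it is imposed on whole runs by `FitsIn` below, so
-- arithmetic never wraps around.

Reg : ℕ → Set
Reg r = Fin (suc r)

Label : Set
Label = ℕ

data Instr (r : ℕ) : Set where
  const : (d : Reg r) (v : ℕ)   → Instr r
  add   : (d x y : Reg r)       → Instr r
  sub   : (d x y : Reg r)       → Instr r
  load  : (d a : Reg r)         → Instr r
  store : (a x : Reg r)         → Instr r
  jump  : (l : Label)           → Instr r
  jzero : (x : Reg r) (l : Label) → Instr r
  halt  : (verdict : Bool)      → Instr r

Program : ℕ → Set
Program r = List (Instr r)

Memory : Set
Memory = ℕ → ℕ

_[_↦_] : Memory → ℕ → ℕ → Memory
(μ [ a ↦ v ]) b = if b ≡ᵇ a then v else μ b

data Config (r : ℕ) : Set where
  running : (pc : Label) (ρ : Vec ℕ (suc r)) (μ : Memory) → Config r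
  halted  : (verdict : Bool) → Config r

fetch : ∀ {r} → Program r → Label → Maybe (Instr r)
fetch P pc = head (drop pc P)

-- Leaving the program text without executing `halt` (the case `nothing`)
-- is a divergence, not a verdict.

exec : ∀ {r} → Maybe (Instr r) → Label → Vec ℕ (suc r) → Memory → Config r
exec nothing            pc ρ μ = running pc ρ μ
exec (just (const d v)) pc ρ μ = running (suc pc) (ρ [ d ]≔ v) μ
exec (just (add d x y)) pc ρ μ = running (suc pc) (ρ [ d ]≔ (lookup ρ x + lookup ρ y)) μ
exec (just (sub d x y)) pc ρ μ = running (suc pc) (ρ [ d ]≔ (lookup ρ x ∸ lookup ρ y)) μ
exec (just (load d a))  pc ρ μ = running (suc pc) (ρ [ d ]≔ μ (lookup ρ a)) μ
exec (just (store a x)) pc ρ μ = running (suc pc) ρ (μ [ lookup ρ a ↦ lookup ρ x ])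
exec (just (jump l))    pc ρ μ = running l ρ μ
exec (just (jzero x l)) pc ρ μ = running (if lookup ρ x ≡ᵇ 0 then l else suc pc) ρ μ
exec (just (halt b))    pc ρ μ = halted b

step : ∀ {r} → Program r → Config r → Config r
step P (running pc ρ μ) = exec (fetch P pc) pc ρ μ
step P (halted b)       = halted b

initial : ∀ {r} → ℕ → Config r
initial {r} n = running 0 (n ∷ replicate r 0) (λ _ → 0)

runFor : ∀ {r} → Program r → ℕ → ℕ → Config r
runFor P n t = iterate (step P) (initial n) t

-- Every register and every memory cell is a w-bit word.  Addresses are
-- register contents, so this bounds the addresses in use as well.

FitsIn : ∀ {r} → ℕ → Config r → Set
FitsIn w (running pc ρ μ) = All (_< 2 ^ w) ρ × (∀ a → μ a < 2 ^ w)
FitsIn w (halted b)       = ⊤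

bitLength : ℕ → ℕ
bitLength n = suc ⌊log₂ n ⌋

record Decides {r} (P : Program r) (n : ℕ) (A : Set) (T w : ℕ) : Set where
  field
    verdict   : Bool
    time      : ℕ
    time≤T    : time ≤ T
    halts     : runFor P n time ≡ halted verdict
    correct   : Reflects A verdict
    wordSized : ∀ t → FitsIn w (runFor P n t)

{-# OPTIONS --safe #-}

-- Appending a binary digit to m doubles m and possibly adds one, so the least
-- s₂ of a positive multiple of n is one more than the least cost of a path from
-- 1 to 0 in the graph on ℤ/n with edges x → 2x of cost 0 and x → x + 1 of cost 1;
-- paths do not underestimate it because s₂ (m + 1) ≤ s₂ m + 1.  A breadth-first
-- search with a single FIFO queue finds this cost: whenever a node is labelled,
-- so is, at the same cost, the chain of its doubles up to the first one already
-- labelled.  Every node is enqueued once, so the search is linear.  s₂ n itself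
-- is found by repeated halving, where even halving by repeated subtraction of 2
-- is cheap enough, since n + n/2 + n/4 + … ≤ 2n.
module Submission where

open import Defs
open import Data.Bool.Base using (true; false; if_then_else_; T)
open import Data.Digit using (toDigits; fromDigits)
open import Data.Empty using (⊥-elim)
open import Data.Fin.Base using (Fin; toℕ; zero; suc)
open import Data.Fin.Patterns
open import Data.List.Base using (List; []; _∷_; map)
import Data.List.Relation.Unary.All as List
open import Data.Maybe.Base using (just; nothing)
import Data.Maybe.Relation.Unary.All as Maybe
open import Data.Nat.Base
open import Data.Nat.Divisibility using (divides; ∣m+n∣m⇒∣n; ∣⇒≤)
open import Data.Nat.GeneralisedArithmetic using (iterate)
open import Data.Nat.Induction using (<-rec)
open import Data.Nat.ListAction using (sum)
open import Data.Nat.Logarithm using (⌊log₂⌋-mono-≤; ⌊log₂[2^n]⌋≡n)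
open import Data.Nat.Properties
open import Data.Nat.Tactic.RingSolver using (solve-∀)
open import Data.Product.Base using (Σ-syntax; ∃-syntax; _×_; _,_; proj₁; proj₂; uncurry)
open import Data.Sum.Base using (_⊎_; inj₁; inj₂)
open import Data.Unit.Base using (⊤; tt)
open import Data.Vec.Base using (Vec; []; _∷_; lookup; _[_]≔_)
open import Data.Vec.Relation.Unary.All as Vec using ([]; _∷_)
open import Data.Vec.Relation.Unary.All.Properties using (lookup⁺)
open import Relation.Binary.PropositionalEquality
open import Relation.Nullary.Decidable.Core using (yes; no; toWitness)
open import Relation.Nullary.Negation using (¬_; contradiction)
open import Relation.Nullary.Reflects using (Reflects; ofʸ; ofⁿ)

-- Binary digit sums

digitSum : List (Fin 2) → ℕ
digitSum ds = sum (map toℕ ds)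

-- The lists may carry leading zeros and so differ in length. Parity makes the lowest digits agree,
-- and an empty list can only face zeros.
digitSum-unique : ∀ ds es → fromDigits ds ≡ fromDigits es → digitSum ds ≡ digitSum es
digitSum-unique []             []             eq = refl
digitSum-unique []             (zero ∷ es)    eq =
  digitSum-unique [] es (sym (m*n≡0⇒m≡0 _ 2 (sym eq)))
digitSum-unique (zero ∷ ds)    []             eq =
  digitSum-unique ds [] (m*n≡0⇒m≡0 _ 2 eq)
digitSum-unique (zero ∷ ds)    (zero ∷ es)    eq =
  digitSum-unique ds es (*-cancelʳ-≡ _ _ 2 eq)
digitSum-unique (zero ∷ ds)    (suc zero ∷ es) eq =
  contradiction
    (trans (*-comm 2 (fromDigits ds)) (trans eq (cong suc (*-comm (fromDigits es) 2))))
    (even≢odd (fromDigits ds) (fromDigits es))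
digitSum-unique (suc zero ∷ ds) (zero ∷ es)   eq =
  contradiction
    (trans (*-comm 2 (fromDigits es)) (trans (sym eq) (cong suc (*-comm (fromDigits ds) 2))))
    (even≢odd (fromDigits es) (fromDigits ds))
digitSum-unique (suc zero ∷ ds) (suc zero ∷ es) eq =
  cong suc (digitSum-unique ds es (*-cancelʳ-≡ _ _ 2 (suc-injective eq)))

-- With this, `s₂` may be read off from any digit list of a number, such as the digits of `m` with
-- one more put at the low end.
s₂-fromDigits : ∀ ds → s₂ (fromDigits ds) ≡ digitSum ds
s₂-fromDigits ds =
  digitSum-unique (proj₁ (toDigits 2 (fromDigits ds))) ds (proj₂ (toDigits 2 (fromDigits ds)))

double-*2 : ∀ m → m + m ≡ m * 2
double-*2 = solve-∀

s₂-double : ∀ m → s₂ (m + m) ≡ s₂ m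
s₂-double m = trans
  (cong s₂ (trans (double-*2 m) (cong (_* 2) (sym (proj₂ (toDigits 2 m))))))
  (s₂-fromDigits (zero ∷ proj₁ (toDigits 2 m)))

s₂-1+double : ∀ m → s₂ (suc (m + m)) ≡ suc (s₂ m)
s₂-1+double m = trans
  (cong (λ k → s₂ (suc k)) (trans (double-*2 m) (cong (_* 2) (sym (proj₂ (toDigits 2 m))))))
  (s₂-fromDigits (suc zero ∷ proj₁ (toDigits 2 m)))

data ParityView : ℕ → Set where
  even : ∀ j → ParityView (j + j)
  odd  : ∀ j → ParityView (suc (j + j))

parityView : ∀ m → ParityView m
parityView zero = even 0
parityView (suc m) with parityView m
... | even j = odd j
... | odd j  = subst ParityView (cong suc (+-suc j j)) (even (suc j))

-- Adding one to `j + j` only sets the last digit. Adding one to `suc (j + j)` carries and gives the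
-- double of `suc j`, which the induction hypothesis at `j` bounds.
s₂-suc : ∀ m → s₂ (suc m) ≤ suc (s₂ m)
s₂-suc = <-rec _ go
  where
  open ≤-Reasoning
  go : ∀ m → (∀ {k} → k < m → s₂ (suc k) ≤ suc (s₂ k)) → s₂ (suc m) ≤ suc (s₂ m)
  go m rec with parityView m
  ... | even j = ≤-reflexive (trans (s₂-1+double j) (cong suc (sym (s₂-double j))))
  ... | odd j  = begin
    s₂ (2+ (j + j))          ≡⟨ cong (λ k → s₂ (suc k)) (+-suc j j) ⟨
    s₂ (suc j + suc j)       ≡⟨ s₂-double (suc j) ⟩
    s₂ (suc j)               ≤⟨ rec (s≤s (m≤m+n j j)) ⟩
    suc (s₂ j)               ≡⟨ s₂-1+double j ⟨
    s₂ (suc (j + j))         ≤⟨ n≤1+n _ ⟩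
    suc (s₂ (suc (j + j)))   ∎

s₂≤id : ∀ m → s₂ m ≤ m
s₂≤id zero    = z≤n
s₂≤id (suc m) = ≤-trans (s₂-suc m) (s≤s (s₂≤id m))

n<2^bitLength : ∀ n → n < 2 ^ bitLength n
n<2^bitLength n = ≰⇒> λ 2^b≤n →
  <-irrefl refl (≤-trans (≤-reflexive (sym (⌊log₂[2^n]⌋≡n (bitLength n)))) (⌊log₂⌋-mono-≤ 2^b≤n))

-- Runs of bounded length and word size

iterate-+ : ∀ {A : Set} (f : A → A) j k x → iterate f x (j + k) ≡ iterate f (iterate f x j) k
iterate-+ f zero    k x = refl
iterate-+ f (suc j) k x = iterate-+ f j k (f x)

-- The bound is any number, not a power of 2 as in `FitsIn`, so that it can start out linear in the
-- input and grow by doubling.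
Bounded : ∀ {r} → ℕ → Config r → Set
Bounded B (running pc ρ μ) = Vec.All (_≤ B) ρ × (∀ a → μ a ≤ B)
Bounded B (halted b)       = ⊤

Bounded-mono : ∀ {r B B′} → B ≤ B′ → (c : Config r) → Bounded B c → Bounded B′ c
Bounded-mono B≤B′ (running pc ρ μ) (ρ≤ , μ≤) =
  Vec.map (λ v≤B → ≤-trans v≤B B≤B′) ρ≤ , λ a → ≤-trans (μ≤ a) B≤B′
Bounded-mono B≤B′ (halted b)       _         = tt

Bounded⇒FitsIn : ∀ {r B w} → B < 2 ^ w → (c : Config r) → Bounded B c → FitsIn w c
Bounded⇒FitsIn B<2^w (running pc ρ μ) (ρ≤ , μ≤) =
  Vec.map (λ v≤B → ≤-<-trans v≤B B<2^w) ρ≤ , λ a → ≤-<-trans (μ≤ a) B<2^w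
Bounded⇒FitsIn B<2^w (halted b)       _         = tt

All-≔ : ∀ {n} {Q : ℕ → Set} {ρ : Vec ℕ n} i {v} → Vec.All Q ρ → Q v → Vec.All Q (ρ [ i ]≔ v)
All-≔ zero    (_ ∷ qs) q′ = q′ ∷ qs
All-≔ (suc i) (q ∷ qs) q′ = q ∷ All-≔ i qs q′

constant : ∀ {r} → Instr r → ℕ
constant (const d v) = v
constant _           = 0

SmallConstant : ∀ {r} → Instr r → Set
SmallConstant i = constant i ≤ 1

fetch⁺ : ∀ {r} {Q : Instr r → Set} {P} pc → List.All Q P → Maybe.All Q (fetch P pc)
fetch⁺ zero     List.[]       = Maybe.nothing
fetch⁺ (suc pc) List.[]       = Maybe.nothing
fetch⁺ zero     (q List.∷ qs) = Maybe.just q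
fetch⁺ (suc pc) (q List.∷ qs) = fetch⁺ pc qs

-- Only `add` can produce a word above `B`; what `const` writes is at most 1, hence at most `B`.
exec-Bounded : ∀ {r B} → 1 ≤ B → ∀ {i pc} {ρ : Vec ℕ (suc r)} {μ} →
               Maybe.All SmallConstant i → Bounded B (running pc ρ μ) →
               Bounded (B + B) (exec i pc ρ μ)
exec-Bounded {B = B} 1≤B {i} {pc} {ρ} {μ} small (ρ≤ , μ≤) = go i small
  where
  ρ≤2B : Vec.All (_≤ B + B) ρ
  ρ≤2B = Vec.map (λ v≤B → ≤-trans v≤B (m≤m+n B B)) ρ≤

  μ≤2B : ∀ a → μ a ≤ B + B
  μ≤2B a = ≤-trans (μ≤ a) (m≤m+n B B)

  write : ∀ d {v} → v ≤ B + B → Bounded (B + B) (running pc (ρ [ d ]≔ v) μ)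
  write d v≤ = All-≔ d ρ≤2B v≤ , μ≤2B

  go : ∀ i → Maybe.All SmallConstant i → Bounded (B + B) (exec i pc ρ μ)
  go nothing            _              = ρ≤2B , μ≤2B
  go (just (const d v)) (Maybe.just v≤1) = write d (≤-trans v≤1 (≤-trans 1≤B (m≤m+n B B)))
  go (just (add d x y)) _              = write d (+-mono-≤ (lookup⁺ ρ≤ x) (lookup⁺ ρ≤ y))
  go (just (sub d x y)) _              = write d (≤-trans (m∸n≤m _ (lookup ρ y)) (lookup⁺ ρ≤2B x))
  go (just (load d a))  _              = write d (μ≤2B _)
  go (just (store a x)) _              = ρ≤2B , stored
    where
    stored : ∀ b → (μ [ lookup ρ a ↦ lookup ρ x ]) b ≤ B + B
    stored b with b ≡ᵇ lookup ρ a
    ... | true  = lookup⁺ ρ≤2B x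
    ... | false = μ≤2B b
  go (just (jump l))    _              = ρ≤2B , μ≤2B
  go (just (jzero x l)) _              = ρ≤2B , μ≤2B
  go (just (halt b))    _              = tt

module _ {r : ℕ} (P : Program r) where

  -- A trace up to the verdict that bounds every configuration on the way, since `Decides` asks for
  -- the word size at all times.
  data Run (A : Set) (B : ℕ) : ℕ → Config r → Set where
    stop : ∀ {b} → Reflects A b → Run A B 0 (halted b)
    tick : ∀ {k c} → Bounded B c → Run A B k (step P c) → Run A B (suc k) c

  Run⇒halts : ∀ {A B k c} → Run A B k c → ∃[ b ] iterate (step P) c k ≡ halted b × Reflects A b
  Run⇒halts (stop reflects) = _ , refl , reflects
  Run⇒halts (tick _ run)    = Run⇒halts run

  Run⇒Bounded : ∀ {A B k c} → Run A B k c → ∀ t → Bounded B (iterate (step P) c t)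
  Run⇒Bounded (stop _)         zero    = tt
  -- `step` fixes a halted configuration, so the times after the verdict are covered too.
  Run⇒Bounded (stop reflects)  (suc t) = Run⇒Bounded (stop reflects) t
  Run⇒Bounded (tick bounded _) zero    = bounded
  Run⇒Bounded (tick _ run)     (suc t) = Run⇒Bounded run t

  Run⇒Decides : ∀ {n A B k T w} → k ≤ T → B < 2 ^ w → Run A B k (initial n) → Decides P n A T w
  Run⇒Decides k≤T B<2^w run with Run⇒halts run
  ... | b , halts , reflects = record
    { verdict   = b
    ; time      = _
    ; time≤T    = k≤T
    ; halts     = halts
    ; correct   = reflects
    ; wordSized = λ t → Bounded⇒FitsIn B<2^w _ (Run⇒Bounded run t)
    }

  module _ (small : List.All SmallConstant P) where

    step-Bounded : ∀ {B} → 1 ≤ B → ∀ c → Bounded B c → Bounded (B + B) (step P c)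
    step-Bounded 1≤B (running pc ρ μ) bounded = exec-Bounded 1≤B (fetch⁺ pc small) bounded
    step-Bounded 1≤B (halted b)       _       = tt

    -- Each step at most doubles the largest word.
    prepend : ∀ {A B B′ m c} k → 1 ≤ B → Bounded B c → 2 ^ k * B ≤ B′ →
              Run A B′ m (iterate (step P) c k) → Run A B′ (k + m) c
    prepend zero    _   _       _  run = run
    prepend {B = B} {c = c} (suc k) 1≤B bounded B≤ run =
      tick (Bounded-mono (≤-trans (m≤n*m B (2 ^ suc k) {{m^n≢0 2 (suc k)}}) B≤) c bounded)
           (prepend k (≤-trans 1≤B (m≤m+n B B)) (step-Bounded 1≤B c bounded)
                    (≤-trans (≤-reflexive (shift (2 ^ k) B)) B≤) run)
      where
      shift : ∀ p b → p * (b + b) ≡ (p + (p + 0)) * b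
      shift = solve-∀

    -- Cuts a run into stretches of at most `K` steps: invariants are stated only where a stretch
    -- begins, and `prepend` controls the words in between.
    data Progress (A : Set) (K : ℕ) (Next : Config r → Set) (c : Config r) : Set where
      halting    : ∀ {b} k → k ≤ K → iterate (step P) c k ≡ halted b → Reflects A b →
                   Progress A K Next c
      continuing : ∀ {c′} k → k ≤ K → iterate (step P) c k ≡ c′ → Next c′ →
                   Progress A K Next c

    -- The first argument of Checkpoint is fuel, bounding the number of
    -- checkpoints still to come.
    runFrom : ∀ {A K B} → 1 ≤ B → (Checkpoint : ℕ → Config r → Set) →
              (∀ {p c} → Checkpoint p c → Bounded B c) →
              (∀ {c} → ¬ Checkpoint 0 c) →
              (∀ {p c} → Checkpoint (suc p) c → Progress A K (Checkpoint p) c) →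
              ∀ p {c} → Checkpoint p c → ∃[ k ] k ≤ p * K × Run A (2 ^ K * B) k c
    runFrom {A} {K} {B} 1≤B Checkpoint bounded nonEmpty progress = go
      where
      extend : ∀ {k m c} → k ≤ K → Bounded B c → Run A (2 ^ K * B) m (iterate (step P) c k) →
               Run A (2 ^ K * B) (k + m) c
      extend {k} k≤K bc run = prepend k 1≤B bc (*-monoˡ-≤ B (^-monoʳ-≤ 2 k≤K)) run

      go : ∀ p {c} → Checkpoint p c → ∃[ k ] k ≤ p * K × Run A (2 ^ K * B) k c
      go zero    ch = contradiction ch nonEmpty
      go (suc p) ch with progress ch
      ... | halting k k≤K eq reflects =
        _ , +-mono-≤ k≤K z≤n , extend k≤K (bounded ch) (subst (Run A _ 0) (sym eq) (stop reflects))
      ... | continuing k k≤K eq next with go p next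
      ...   | m , m≤ , run =
        _ , +-mono-≤ k≤K m≤ , extend k≤K (bounded ch) (subst (Run A _ m) (sym eq) run)

-- The search and its invariant

update-same : ∀ μ a v → (μ [ a ↦ v ]) a ≡ v
update-same μ a v with a ≡ᵇ a in eq
... | true  = refl
... | false = ⊥-elim (subst T eq (≡⇒≡ᵇ a a refl))

update-other : ∀ μ {a b} v → b ≢ a → (μ [ a ↦ v ]) b ≡ μ b
update-other μ {a} {b} v b≢a with b ≡ᵇ a in eq
... | true  = contradiction (≡ᵇ⇒≡ b a (subst T (sym eq) tt)) b≢a
... | false = refl

update-≤ : ∀ {μ B v} a → (∀ b → μ b ≤ B) → v ≤ B → ∀ b → (μ [ a ↦ v ]) b ≤ B
update-≤ a μ≤ v≤ b with b ≡ᵇ a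
... | true  = v≤
... | false = μ≤ b

-- Counting unlabelled addresses

zeros : Memory → ℕ → ℕ
zeros μ zero    = 0
zeros μ (suc k) = (if μ (suc k) ≡ᵇ 0 then 1 else 0) + zeros μ k

zeros-replicate : ∀ k → zeros (λ _ → 0) k ≡ k
zeros-replicate zero    = refl
zeros-replicate (suc k) = cong suc (zeros-replicate k)

zeros-cong : ∀ {μ μ′} k → (∀ x → x ≤ k → μ′ x ≡ μ x) → zeros μ′ k ≡ zeros μ k
zeros-cong zero    eq = refl
zeros-cong (suc k) eq = cong₂ (λ v z → (if v ≡ᵇ 0 then 1 else 0) + z)
  (eq (suc k) ≤-refl) (zeros-cong k λ x x≤k → eq x (m≤n⇒m≤1+n x≤k))

-- Only the summand of `y` changes, from 1 to 0. The induction descends until `suc k` is `y`, below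
-- which the memories agree.
zeros-fill : ∀ {μ μ′ y} k → 1 ≤ y → y ≤ k → μ y ≡ 0 → 1 ≤ μ′ y →
             (∀ x → x ≤ k → x ≢ y → μ′ x ≡ μ x) → zeros μ k ≡ suc (zeros μ′ k)
zeros-fill zero 1≤y y≤0 _ _ _ = contradiction (≤-trans 1≤y y≤0) λ ()
zeros-fill {μ} {μ′} {y} (suc k) 1≤y y≤1+k μy≡0 1≤μ′y same with y ≟ suc k
... | yes refl with μ (suc k) | μ′ (suc k) | μy≡0 | 1≤μ′y
...   | zero | suc _ | _ | _ =
  cong suc (sym (zeros-cong k λ x x≤k → same x (m≤n⇒m≤1+n x≤k) (<⇒≢ (s≤s x≤k))))
zeros-fill {μ} {μ′} {y} (suc k) 1≤y y≤1+k μy≡0 1≤μ′y same | no y≢1+k =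
  trans (cong₂ (λ v z → (if v ≡ᵇ 0 then 1 else 0) + z)
               (sym (same (suc k) ≤-refl (≢-sym y≢1+k)))
               (zeros-fill k 1≤y (s≤s⁻¹ (≤∧≢⇒< y≤1+k y≢1+k)) μy≡0 1≤μ′y
                           λ x x≤k → same x (m≤n⇒m≤1+n x≤k)))
        (+-suc _ _)

module _ (n : ℕ) where

  -- The residues modulo n are represented by 1, …, n.
  Node : ℕ → Set
  Node x = 1 ≤ x × x ≤ n

  -- One subtraction suffices, as doubles and successors of nodes are at most `n + n`. The test
  -- copies the program: truncated subtraction gives 0 when `y ≤ n`, so `n` stays and represents the
  -- residue 0.
  reduce : ℕ → ℕ
  reduce y = if (y ∸ n) ≡ᵇ 0 then y else y ∸ n

  reduce-spec : ∀ {y} → 1 ≤ y → y ≤ n + n → Node (reduce y) × ∃[ b ] y ≡ reduce y + b * n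
  reduce-spec {y} 1≤y y≤2n with y ∸ n in eq
  ... | zero  = (1≤y , m∸n≡0⇒m≤n eq) , 0 , sym (+-identityʳ y)
  ... | suc w = (s≤s z≤n , +-cancelʳ-≤ n (suc w) n (≤-trans (≤-reflexive (sym y≡)) y≤2n)) ,
                1 , trans y≡ (cong (suc w +_) (sym (+-identityʳ n)))
    where
    y≡ : y ≡ suc w + n
    y≡ = trans (sym (m∸n+n≡m (<⇒≤ (m∸n≢0⇒n<m {y} {n} λ z → 1+n≢0 (trans (sym eq) z)))))
               (cong (_+ n) eq)

  -- Certifies that the label `d` is not too small. Of the path to `x` only the number that it
  -- builds is kept.
  record Cost (x d : ℕ) : Set where
    constructor _,_
    field
      quotient : ℕ
      s₂≤      : s₂ (x + quotient * n) ≤ d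

  Cost-reduce : ∀ {y d} → 1 ≤ y → y ≤ n + n → Cost y d → Cost (reduce y) d
  Cost-reduce {y} {d} 1≤y y≤2n (a , cost) with reduce-spec 1≤y y≤2n
  ... | _ , b , y≡ =
    b + a , subst (λ m → s₂ m ≤ d) (trans (cong (_+ a * n) y≡) (regroup (reduce y) a b n)) cost
    where
    regroup : ∀ r a b n → r + b * n + a * n ≡ r + (b + a) * n
    regroup = solve-∀

  Cost-double : ∀ {y d} → Cost y d → Cost (y + y) d
  Cost-double {y} (a , cost) =
    a + a , ≤-trans (≤-reflexive (trans (cong s₂ (regroup y a n)) (s₂-double (y + a * n)))) cost
    where
    regroup : ∀ y a n → y + y + (a + a) * n ≡ (y + a * n) + (y + a * n)
    regroup = solve-∀

  Cost-suc : ∀ {y d} → Cost y d → Cost (suc y) (suc d)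
  Cost-suc {y} (a , cost) = a , ≤-trans (s₂-suc (y + a * n)) (s≤s cost)

  Labelled : Memory → ℕ → ℕ → Set
  Labelled μ x d = 1 ≤ μ x × μ x ≤ d

  -- Certifies that labels are not too large: doubling edges count once their source is labelled,
  -- increment edges once it is dequeued. `Reached` is a parameter so that a pending edge can be
  -- excepted.
  record Closed (μ : Memory) (h : ℕ) (Reached : ℕ → ℕ → Set) : Set where
    field
      start       : Reached 1 1
      doubled     : ∀ {x} → Node x → 1 ≤ μ x → Reached (reduce (x + x)) (μ x)
      incremented : ∀ {i} → n < i → i ≤ h → Reached (reduce (suc (μ i))) (suc (μ (μ i)))

  Closed-map : ∀ {μ h} {R S : ℕ → ℕ → Set} → (∀ {x d} → R x d → S x d) → Closed μ h R → Closed μ h S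
  Closed-map f closed = record
    { start       = f start
    ; doubled     = λ nx 1≤ → f (doubled nx 1≤)
    ; incremented = λ n<i i≤h → f (incremented n<i i≤h)
    }
    where open Closed closed

  -- Labels are stored at the addresses 1, …, n (with 0 for unlabelled), the
  -- queue at n + 1, …, t; its entries up to h have been dequeued, and e is
  -- one more than the label of the last of these (1 before the first).
  record Queue (h t e : ℕ) (μ : Memory) : Set where
    field
      n≤h      : n ≤ h
      h≤t      : h ≤ t
      -- The `t ∸ n` enqueued nodes and the unlabelled ones together make up all `n` nodes.
      filled   : t + zeros μ n ≡ n + n
      1≤e      : 1 ≤ e
      -- Each dequeuing raises `h` by one and `e` by at most one. As `h` is at most `n + n`, labels
      -- stay within the word bound `suc (n + n)`.
      e≤1+h    : e ≤ suc h
      word     : ∀ a → μ a ≤ suc (n + n)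
      queued   : ∀ {i} → n < i → i ≤ t → Node (μ i) × 1 ≤ μ (μ i)
      enqueued : ∀ {x} → Node x → 1 ≤ μ x → ∃[ i ] n < i × i ≤ t × μ i ≡ x
      -- With `e≤1+next` and `sorted` this is the breadth-first order: waiting entries carry the
      -- label `e ∸ 1`, and after those `e`.
      label≤e  : ∀ {x} → Node x → μ x ≤ e
      e≤1+next : ∀ {i} → h < i → i ≤ t → e ≤ suc (μ (μ i))
      sorted   : ∀ {i j} → h < i → i ≤ j → j ≤ t → μ (μ i) ≤ μ (μ j)
      cost     : ∀ {x} → Node x → 1 ≤ μ x → Cost x (μ x)

    t≤2n : t ≤ n + n
    t≤2n = ≤-trans (m≤m+n t _) (≤-reflexive filled)

  -- y is about to be labelled e unless it already has a label; until then the
  -- edges into y may be unsettled.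
  record Searching (y h t e : ℕ) (μ : Memory) : Set where
    field
      queue  : Queue h t e μ
      node   : Node y
      reach  : Cost y e
      closed : Closed μ h (λ x d → Labelled μ x d ⊎ (y ≡ x × e ≤ d))
    open Queue queue public

  initially : 1 ≤ n → Searching 1 n n 1 (λ _ → 0)
  initially 1≤n = record
    { queue = record
      { n≤h      = ≤-refl
      ; h≤t      = ≤-refl
      ; filled   = cong (n +_) (zeros-replicate n)
      ; 1≤e      = ≤-refl
      ; e≤1+h    = s≤s z≤n
      ; word     = λ _ → z≤n
      ; queued   = λ n<i i≤n → contradiction i≤n (<⇒≱ n<i)
      ; enqueued = λ _ ()
      ; label≤e  = λ _ → z≤n
      ; e≤1+next = λ n<i i≤n → contradiction i≤n (<⇒≱ n<i)
      ; sorted   = λ n<i i≤j j≤n → contradiction (≤-trans i≤j j≤n) (<⇒≱ n<i)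
      ; cost     = λ _ ()
      }
    ; node   = ≤-refl , 1≤n
    ; reach  = 0 , ≤-reflexive (s₂-1+double 0)
    ; closed = record
      { start       = inj₂ (refl , ≤-refl)
      ; doubled     = λ _ ()
      ; incremented = λ n<i i≤n → contradiction i≤n (<⇒≱ n<i)
      }
    }

  -- Labelling and enqueuing a node

  module Visit {y h t e μ} (searching : Searching y h t e μ) (μy≡0 : μ y ≡ 0) where
    open Searching searching
    open Closed closed

    μ′ : Memory
    μ′ = (μ [ y ↦ e ]) [ suc t ↦ y ]

    1≤y = proj₁ node
    y≤n = proj₂ node

    n≤t : n ≤ t
    n≤t = ≤-trans n≤h h≤t

    -- Labels and queue occupy disjoint addresses, so neither of the two writes disturbs the other.
    ≤n⇒≢1+t : ∀ {x} → x ≤ n → x ≢ suc t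
    ≤n⇒≢1+t x≤n = <⇒≢ (s≤s (≤-trans x≤n n≤t))

    μ′-y : μ′ y ≡ e
    μ′-y = trans (update-other (μ [ y ↦ e ]) y (≤n⇒≢1+t y≤n)) (update-same μ y e)

    μ′-1+t : μ′ (suc t) ≡ y
    μ′-1+t = update-same (μ [ y ↦ e ]) (suc t) y

    μ′-other : ∀ {x} → x ≢ y → x ≢ suc t → μ′ x ≡ μ x
    μ′-other x≢y x≢1+t = trans (update-other (μ [ y ↦ e ]) y x≢1+t) (update-other μ e x≢y)

    μ′-entry : ∀ {i} → n < i → i ≤ t → μ′ i ≡ μ i
    μ′-entry n<i i≤t = μ′-other (≢-sym (<⇒≢ (≤-<-trans y≤n n<i))) (<⇒≢ (s≤s i≤t))

    labelled≢y : ∀ {x} → 1 ≤ μ x → x ≢ y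
    labelled≢y 1≤μx refl = contradiction (subst (1 ≤_) μy≡0 1≤μx) λ ()

    μ′-label : ∀ {x} → Node x → 1 ≤ μ x → μ′ x ≡ μ x
    μ′-label (_ , x≤n) 1≤μx = μ′-other (labelled≢y 1≤μx) (≤n⇒≢1+t x≤n)

    μ′-entry-label : ∀ {i} → n < i → i ≤ t → μ′ (μ′ i) ≡ μ (μ i)
    μ′-entry-label n<i i≤t =
      trans (cong μ′ (μ′-entry n<i i≤t)) (uncurry μ′-label (queued n<i i≤t))

    μ′-1+t-label : μ′ (μ′ (suc t)) ≡ e
    μ′-1+t-label = trans (cong μ′ μ′-1+t) μ′-y

    data LabelView (x : ℕ) : Set where
      new       : x ≡ y → LabelView x
      old       : 1 ≤ μ x → μ′ x ≡ μ x → LabelView x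
      unlabelled : μ′ x ≡ 0 → LabelView x

    label : ∀ {x} → Node x → LabelView x
    label {x} nx with x ≟ y | 1 ≤? μ x
    ... | yes x≡y | _        = new x≡y
    ... | no _    | yes 1≤μx = old 1≤μx (μ′-label nx 1≤μx)
    ... | no x≢y  | no 1≰μx  =
      unlabelled (trans (μ′-other x≢y (≤n⇒≢1+t (proj₂ nx))) (n<1⇒n≡0 (≰⇒> 1≰μx)))

    positive≢0 : ∀ {v} {A : Set} → 1 ≤ v → v ≡ 0 → A
    positive≢0 1≤ eq = contradiction (subst (1 ≤_) eq 1≤) λ ()

    data Position (i : ℕ) : Set where
      last    : i ≡ suc t → Position i
      earlier : i ≤ t → Position i

    position : ∀ {i} → i ≤ suc t → Position i
    position i≤1+t with m≤n⇒m<n∨m≡n i≤1+t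
    ... | inj₁ i<1+t = earlier (s≤s⁻¹ i<1+t)
    ... | inj₂ i≡    = last i≡

    -- The exception for `y` is discharged by the new label, which is `e` itself.
    lift : ∀ {x d} → Node x → Labelled μ x d ⊎ (y ≡ x × e ≤ d) → Labelled μ′ x d
    lift nx (inj₁ (1≤μx , μx≤d)) =
      subst (1 ≤_) (sym (μ′-label nx 1≤μx)) 1≤μx ,
      subst (_≤ _) (sym (μ′-label nx 1≤μx)) μx≤d
    lift nx (inj₂ (refl , e≤d)) = subst (1 ≤_) (sym μ′-y) 1≤e , subst (_≤ _) (sym μ′-y) e≤d

    node-double : ∀ {x} → Node x → Node (reduce (x + x))
    node-double (1≤x , x≤n) =
      proj₁ (reduce-spec (≤-trans 1≤x (m≤m+n _ _)) (+-mono-≤ x≤n x≤n))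

    node-suc : ∀ {x} → Node x → Node (reduce (suc x))
    node-suc (1≤x , x≤n) = proj₁ (reduce-spec (s≤s z≤n) (+-mono-≤ (≤-trans 1≤x x≤n) x≤n))

    filled′ : suc t + zeros μ′ n ≡ n + n
    filled′ = trans (sym (+-suc t _)) (trans (cong (t +_) (sym fill)) filled)
      where
      fill : zeros μ n ≡ suc (zeros μ′ n)
      fill = zeros-fill n 1≤y y≤n μy≡0 (subst (1 ≤_) (sym μ′-y) 1≤e)
                        (λ x x≤n x≢y → μ′-other x≢y (≤n⇒≢1+t x≤n))

    queued′ : ∀ {i} → n < i → i ≤ suc t → Node (μ′ i) × 1 ≤ μ′ (μ′ i)
    queued′ n<i i≤1+t with position i≤1+t
    ... | last refl   = subst Node (sym μ′-1+t) node , subst (1 ≤_) (sym μ′-1+t-label) 1≤e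
    ... | earlier i≤t = subst Node (sym (μ′-entry n<i i≤t)) (proj₁ (queued n<i i≤t)) ,
                        subst (1 ≤_) (sym (μ′-entry-label n<i i≤t)) (proj₂ (queued n<i i≤t))

    enqueued′ : ∀ {x} → Node x → 1 ≤ μ′ x → ∃[ i ] n < i × i ≤ suc t × μ′ i ≡ x
    enqueued′ nx 1≤μ′x with label nx
    ... | new refl       = suc t , s≤s n≤t , ≤-refl , μ′-1+t
    ... | unlabelled eq  = positive≢0 1≤μ′x eq
    ... | old 1≤μx _ with enqueued nx 1≤μx
    ...   | i , n<i , i≤t , μi≡x = i , n<i , m≤n⇒m≤1+n i≤t , trans (μ′-entry n<i i≤t) μi≡x

    label≤e′ : ∀ {x} → Node x → μ′ x ≤ e
    label≤e′ nx with label nx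
    ... | new refl      = ≤-reflexive μ′-y
    ... | old _ eq      = subst (_≤ e) (sym eq) (label≤e nx)
    ... | unlabelled eq = subst (_≤ e) (sym eq) z≤n

    e≤1+next′ : ∀ {i} → h < i → i ≤ suc t → e ≤ suc (μ′ (μ′ i))
    e≤1+next′ h<i i≤1+t with position i≤1+t
    ... | last refl   = subst (λ d → e ≤ suc d) (sym μ′-1+t-label) (n≤1+n e)
    ... | earlier i≤t = subst (λ d → e ≤ suc d) (sym (μ′-entry-label (≤-<-trans n≤h h<i) i≤t))
                              (e≤1+next h<i i≤t)

    sorted′ : ∀ {i j} → h < i → i ≤ j → j ≤ suc t → μ′ (μ′ i) ≤ μ′ (μ′ j)
    sorted′ {i} {j} h<i i≤j j≤1+t with position j≤1+t
    -- The new entry carries `e`, the largest label in use.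
    ... | last refl   = subst (μ′ (μ′ i) ≤_) (sym μ′-1+t-label)
                              (label≤e′ (proj₁ (queued′ (≤-<-trans n≤h h<i) i≤j)))
    ... | earlier j≤t = subst₂ _≤_ (sym (μ′-entry-label (≤-<-trans n≤h h<i) (≤-trans i≤j j≤t)))
                                   (sym (μ′-entry-label (≤-<-trans n≤h (<-≤-trans h<i i≤j)) j≤t))
                                   (sorted h<i i≤j j≤t)

    cost′ : ∀ {x} → Node x → 1 ≤ μ′ x → Cost x (μ′ x)
    cost′ {x} nx 1≤μ′x with label nx
    ... | new refl      = subst (Cost y) (sym μ′-y) reach
    ... | old 1≤μx eq   = subst (Cost x) (sym eq) (cost nx 1≤μx)
    ... | unlabelled eq = positive≢0 1≤μ′x eq

    -- Labelling `y` creates one unsettled edge, to its double. As doubling is free, the bound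
    -- pending there is again `e`.
    doubled′ : ∀ {x} → Node x → 1 ≤ μ′ x →
               Labelled μ′ (reduce (x + x)) (μ′ x) ⊎ (reduce (y + y) ≡ reduce (x + x) × e ≤ μ′ x)
    doubled′ {x} nx 1≤μ′x with label nx
    ... | new refl      = inj₂ (refl , ≤-reflexive (sym μ′-y))
    ... | old 1≤μx eq   = inj₁ (subst (Labelled μ′ (reduce (x + x))) (sym eq)
                                     (lift (node-double nx) (doubled nx 1≤μx)))
    ... | unlabelled eq = positive≢0 1≤μ′x eq

    incremented′ : ∀ {i} → n < i → i ≤ h → Labelled μ′ (reduce (suc (μ′ i))) (suc (μ′ (μ′ i)))
    incremented′ n<i i≤h =
      subst₂ (λ v d → Labelled μ′ (reduce (suc v)) (suc d))
        (sym (μ′-entry n<i (≤-trans i≤h h≤t)))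
        (sym (μ′-entry-label n<i (≤-trans i≤h h≤t)))
        (lift (node-suc (proj₁ (queued n<i (≤-trans i≤h h≤t)))) (incremented n<i i≤h))

    visit : Searching (reduce (y + y)) h (suc t) e μ′
    visit = record
      { queue = record
        { n≤h      = n≤h
        ; h≤t      = m≤n⇒m≤1+n h≤t
        ; filled   = filled′
        ; 1≤e      = 1≤e
        ; e≤1+h    = e≤1+h
        ; word     = update-≤ (suc t)
                       (update-≤ y word (≤-trans e≤1+h (s≤s (≤-trans h≤t t≤2n))))
                       (≤-trans y≤n (m≤n⇒m≤1+n (m≤m+n n n)))
        ; queued   = queued′
        ; enqueued = enqueued′
        ; label≤e  = label≤e′
        ; e≤1+next = e≤1+next′
        ; sorted   = sorted′
        ; cost     = cost′
        }
      ; node   = node-double node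
      ; reach  = Cost-reduce (≤-trans 1≤y (m≤m+n _ _)) (+-mono-≤ y≤n y≤n) (Cost-double reach)
      ; closed = record
        { start       = inj₁ (lift (≤-refl , ≤-trans 1≤y y≤n) start)
        ; doubled     = doubled′
        ; incremented = λ n<i i≤h → inj₁ (incremented′ n<i i≤h)
        }
      }

  open Visit public using (visit)

  -- Dequeuing a node, and the labels once the queue is empty

  module Found {y h t e μ} (searching : Searching y h t e μ) (1≤μy : 1 ≤ μ y) where
    open Searching searching

    -- No label exceeds `e`, so the label that `y` already has meets the bound of every pending
    -- edge.
    settled : Closed μ h (Labelled μ)
    settled = Closed-map
      (λ { (inj₁ labelled)     → labelled
         ; (inj₂ (refl , e≤d)) → 1≤μy , ≤-trans (label≤e node) e≤d })
      closed

    module _ (h<t : h < t) where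
      v : ℕ
      v = μ (suc h)

      v-node : Node v
      v-node = proj₁ (queued (s≤s n≤h) h<t)

      1≤μv : 1 ≤ μ v
      1≤μv = proj₂ (queued (s≤s n≤h) h<t)

      1≤1+v : 1 ≤ suc v
      1≤1+v = s≤s z≤n

      1+v≤2n : suc v ≤ n + n
      1+v≤2n = +-mono-≤ (≤-trans (proj₁ v-node) (proj₂ v-node)) (proj₂ v-node)

      -- Of the edges now demanded only the one from `v` is new, and it becomes the pending one.
      incremented′ : ∀ {i} → n < i → i ≤ suc h →
                     Labelled μ (reduce (suc (μ i))) (suc (μ (μ i))) ⊎
                     (reduce (suc v) ≡ reduce (suc (μ i)) × suc (μ v) ≤ suc (μ (μ i)))
      incremented′ n<i i≤1+h with m≤n⇒m<n∨m≡n i≤1+h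
      ... | inj₁ i<1+h = inj₁ (Closed.incremented settled n<i (s≤s⁻¹ i<1+h))
      ... | inj₂ refl  = inj₂ (refl , ≤-refl)

      dequeue : Searching (reduce (suc v)) (suc h) t (suc (μ v)) μ
      dequeue = record
        { queue = record
          { n≤h      = m≤n⇒m≤1+n n≤h
          ; h≤t      = h<t
          ; filled   = filled
          ; 1≤e      = s≤s z≤n
          ; e≤1+h    = s≤s (≤-trans (label≤e v-node) e≤1+h)
          ; word     = word
          ; queued   = queued
          ; enqueued = enqueued
          -- The old `e` is at most one more than the label of `v`, the first waiting entry.
          ; label≤e  = λ nx → ≤-trans (label≤e nx) (e≤1+next ≤-refl h<t)
          ; e≤1+next = λ h<i i≤t → s≤s (sorted ≤-refl (<⇒≤ h<i) i≤t)
          ; sorted   = λ h<i → sorted (<-trans (n<1+n h) h<i)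
          ; cost     = cost
          }
        ; node   = proj₁ (reduce-spec 1≤1+v 1+v≤2n)
        ; reach  = Cost-reduce 1≤1+v 1+v≤2n (Cost-suc (cost v-node 1≤μv))
        ; closed = record
          { start       = inj₁ (Closed.start settled)
          ; doubled     = λ nx 1≤μx → inj₁ (Closed.doubled settled nx 1≤μx)
          ; incremented = incremented′
          }
        }

    module _ (t≤h : t ≤ h) where

      Bound : ℕ → Set
      Bound m = ∃[ x ] Node x × Labelled μ x (s₂ m) × ∃[ a ] m ≡ x + a * n

      Bound-reduce : ∀ {y m a} → 1 ≤ y → y ≤ n + n → Labelled μ (reduce y) (s₂ m) →
                     m ≡ y + a * n → Bound m
      Bound-reduce {y} {m} {a} 1≤y y≤2n labelled m≡ with reduce-spec 1≤y y≤2n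
      ... | node , b , y≡ =
        reduce y , node , labelled , b + a ,
        trans m≡ (trans (cong (_+ a * n) y≡) (regroup (reduce y) a b n))
        where
        regroup : ∀ r a b n → r + b * n + a * n ≡ r + (b + a) * n
        regroup = solve-∀

      Bound-1 : Bound 1
      Bound-1 = 1 , (≤-refl , ≤-trans (proj₁ node) (proj₂ node)) ,
                subst (Labelled μ 1) (sym (s₂-1+double 0)) (Closed.start settled) , 0 , refl

      Bound-double : ∀ j → Bound j → Bound (j + j)
      Bound-double j (x , nx@(1≤x , x≤n) , (1≤μx , μx≤) , a , j≡)
        with Closed.doubled settled nx 1≤μx
      ... | 1≤ , ≤μx =
        Bound-reduce {a = a + a} (≤-trans 1≤x (m≤m+n x x)) (+-mono-≤ x≤n x≤n)
          (1≤ , ≤-trans ≤μx (≤-trans μx≤ (≤-reflexive (sym (s₂-double j)))))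
          (trans (cong₂ _+_ j≡ j≡) (regroup x a n))
        where
        regroup : ∀ x a n → (x + a * n) + (x + a * n) ≡ (x + x) + (a + a) * n
        regroup = solve-∀

      -- Uses the increment edge from the even predecessor. That edge is settled because the queue
      -- is empty: every labelled node has an entry, and all entries have been dequeued.
      Bound-1+double : ∀ j → Bound (j + j) → Bound (suc (j + j))
      Bound-1+double j (x , nx@(1≤x , x≤n) , (1≤μx , μx≤) , a , 2j≡) with enqueued nx 1≤μx
      ... | i , n<i , i≤t , refl with Closed.incremented settled n<i (≤-trans i≤t t≤h)
      ...   | 1≤ , ≤1+μx =
        Bound-reduce {a = a} (s≤s z≤n) (+-mono-≤ (≤-trans 1≤x x≤n) x≤n)
          (1≤ , ≤-trans ≤1+μx (≤-trans (s≤s μx≤) (≤-reflexive 1+s₂)))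
          (cong suc 2j≡)
        where
        1+s₂ : suc (s₂ (j + j)) ≡ s₂ (suc (j + j))
        1+s₂ = trans (cong suc (s₂-double j)) (sym (s₂-1+double j))

      -- Writing `m` digit by digit from the top traces a path from 1 of total cost `s₂ m`, and no
      -- label exceeds the cost of a path.
      label-bound : ∀ m → 1 ≤ m → Bound m
      label-bound = <-rec _ go
        where
        go : ∀ m → (∀ {k} → k < m → 1 ≤ k → Bound k) → 1 ≤ m → Bound m
        go m rec 1≤m with parityView m
        ... | even zero    = contradiction 1≤m λ ()
        ... | even (suc j) = Bound-double (suc j) (rec (m<m+n (suc j) (s≤s z≤n)) (s≤s z≤n))
        ... | odd zero     = Bound-1
        ... | odd (suc j)  = Bound-1+double (suc j) (rec ≤-refl (s≤s z≤n))

      n-node : Node n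
      n-node = ≤-trans (proj₁ node) (proj₂ node) , ≤-refl

      label-n : ∀ {k} → 1 ≤ k → Labelled μ n (s₂ (k * n))
      label-n {suc k} _ with label-bound (suc k * n) (≤-trans (proj₁ n-node) (m≤m+n n (k * n)))
      ... | x , (1≤x , x≤n) , labelled , a , kn≡ = subst (λ x → Labelled μ x _) x≡n labelled
        where
        x≡n : x ≡ n
        -- `x` is the difference of two multiples of `n`, so `n` divides it, and it is positive.
        x≡n = ≤-antisym x≤n (∣⇒≤ {{>-nonZero 1≤x}}
          (∣m+n∣m⇒∣n (divides (suc k) (trans (+-comm (a * n) x) (sym kn≡))) (divides a refl)))

      sturdy : s₂ n ≤ μ n → Sturdy n
      sturdy s₂n≤ (k , 0<k , s₂kn<) =
        <-irrefl refl (<-≤-trans s₂kn< (≤-trans s₂n≤ (proj₂ (label-n 0<k))))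

      flimsy : μ n < s₂ n → Flimsy n
      flimsy <s₂n with cost n-node (proj₁ (label-n ≤-refl))
      -- `n + a * n` is `suc a * n` by definition, so the multiplier is positive.
      ... | a , s₂≤ = suc a , s≤s z≤n , ≤-<-trans s₂≤ <s₂n

-- The program

-- `rs` accumulates `s₂ n`, `ry` is the current node, `rh` and `rt` delimit the queue, `re` is the
-- next label and `rv` is scratch. During halving `ry` is what remains and `rh` the quotient so far.
pattern rn = 0F
pattern r1 = 1F
pattern r0 = 2F
pattern rs = 3F
pattern ry = 4F
pattern rh = 5F
pattern rt = 6F
pattern re = 7F
pattern rv = 8F

-- Addresses 2–12 compute s₂ n by halving, 17–34 are the search, and 35–39
-- compare the label of n with s₂ n.
program : Program 8
program =
    const r1 1
  -- In additions the constant registers come first, so that `0 + y` and `1 + y` reduce for a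
  -- variable `y` and runs can be checked by `refl`.
  ∷ add ry r0 rn
  ∷ jzero ry 9          -- 2
  ∷ sub ry ry r1
  ∷ jzero ry 8
  ∷ sub ry ry r1
  ∷ add rh r1 rh
  ∷ jump 2
  ∷ add rs r1 rs        -- 8
  ∷ jzero rh 13         -- 9
  ∷ add ry r0 rh
  ∷ const rh 0
  ∷ jump 2
  ∷ add ry r0 r1        -- 13
  ∷ add rh r0 rn
  ∷ add rt r0 rn
  ∷ const re 1
  ∷ load rv ry          -- 17
  ∷ jzero rv 27
  ∷ sub rv rt rh
  ∷ jzero rv 35
  ∷ add rh r1 rh
  ∷ load ry rh
  ∷ load re ry
  ∷ add re r1 re
  ∷ add ry r1 ry
  ∷ jump 31
  ∷ store ry re         -- 27
  ∷ add rt r1 rt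
  ∷ store rt ry
  ∷ add ry ry ry
  ∷ sub rv ry rn        -- 31
  ∷ jzero rv 17
  ∷ add ry r0 rv
  ∷ jump 17
  ∷ load rv rn          -- 35
  ∷ sub rv rs rv
  ∷ jzero rv 39
  ∷ halt false
  ∷ halt true           -- 39
  ∷ []

program-small : List.All SmallConstant program
program-small = toWitness {a? = List.all? (λ i → constant i ≤? 1) program} tt

-- Execution from checkpoint to checkpoint

module _ (n : ℕ) where

  at : Label → (s y h t e v : ℕ) → Memory → Config 8
  at pc s y h t e v μ = running pc (n ∷ 1 ∷ 0 ∷ s ∷ y ∷ h ∷ t ∷ e ∷ v ∷ []) μ

  run : ℕ → Config 8 → Config 8
  run k c = iterate (step program) c k

  run-trans : ∀ j k c {c′ c″} → run j c ≡ c′ → run k c′ ≡ c″ → run (j + k) c ≡ c″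
  run-trans j k c eq eq′ = trans (iterate-+ (step program) j k c) (trans (cong (run k) eq) eq′)

  module Block (s y h t e v : ℕ) (μ : Memory) where

    -- The branch depends on `y ∸ n`, which is stuck; with a variable `w` in its place each branch
    -- evaluates.
    reduction : ∃[ k ] k ≤ 4 × run k (at 31 s y h t e v μ) ≡ at 17 s (reduce n y) h t e (y ∸ n) μ
    reduction = let k , k≤3 , eq = conditional (y ∸ n) in suc k , s≤s k≤3 , eq
      where
      conditional : ∀ w → ∃[ k ] k ≤ 3 × run k (at 32 s y h t e w μ) ≡
                    at 17 s (if w ≡ᵇ 0 then y else w) h t e w μ
      conditional zero    = 1 , s≤s z≤n , refl
      conditional (suc w) = 3 , ≤-refl , refl

    visiting : μ y ≡ 0 → run 6 (at 17 s y h t e v μ) ≡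
               at 31 s (y + y) h (suc t) e 0 ((μ [ y ↦ e ]) [ suc t ↦ y ])
    visiting μy≡0 = cong (λ w → run 5 (at 18 s y h t e w μ)) μy≡0

    tested : ∀ {w} → μ y ≡ suc w → run 3 (at 17 s y h t e v μ) ≡ at 20 s y h t e (t ∸ h) μ
    tested μy≡ = cong (λ w → run 2 (at 18 s y h t e w μ)) μy≡

    dequeuing : ∀ {w} → t ∸ h ≡ suc w → run 7 (at 20 s y h t e (t ∸ h) μ) ≡
                at 31 s (suc (μ (suc h))) (suc h) t (suc (μ (μ (suc h)))) (suc w) μ
    dequeuing t∸h≡ = cong (λ w → run 7 (at 20 s y h t e w μ)) t∸h≡

    answering : t ∸ h ≡ 0 → ∀ w → s ∸ μ n ≡ w →
                run 5 (at 20 s y h t e (t ∸ h) μ) ≡ halted (w ≡ᵇ 0)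
    answering t∸h≡0 w s∸μn≡w = trans
      (cong (λ w → run 5 (at 20 s y h t e w μ)) t∸h≡0)
      (trans (cong (λ w → run 2 (at 37 s y h t e w μ)) s∸μn≡w) (last w))
      where
      last : ∀ w → run 2 (at 37 s y h t e w μ) ≡ halted (w ≡ᵇ 0)
      last zero    = refl
      last (suc w) = refl

  -- The heads of the two loops. While halving, `x + (q + q)` is the number whose digits remain to
  -- be summed.
  data Checkpoint (p : ℕ) : Config 8 → Set where
    halving   : ∀ {x q s} → s + s₂ (x + (q + q)) ≡ s₂ n → x + (q + q) ≤ n →
                -- Removing a pair lowers `2x + 3q` by 4 - 3 = 1; restarting on the quotient lowers
                -- it by at least `q`. The term `suc (n + n)` is reserved for the search.
                (x + x + (q + q + q)) + suc (n + n) < p →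
                Checkpoint p (at 2 s x q 0 0 0 (λ _ → 0))
    searching : ∀ {y h t e v μ} → Searching n y h t e μ → v ≤ suc (n + n) →
                -- Each stretch of the search that does not halt raises exactly one of `h` and `t`,
                -- and neither exceeds `n + n`.
                (n + n) + (n + n) < p + (h + t) →
                Checkpoint p (at 17 (s₂ n) y h t e v μ)

  Checkpoint⇒Bounded : ∀ {p c} → Checkpoint p c → Bounded (suc (n + n)) c
  Checkpoint⇒Bounded (halving {x} {q} {s} s≡ x+2q≤n _) =
    ≤N ∷ s≤s z≤n ∷ z≤n ∷
    ≤-trans (≤-trans (m≤m+n s _) (≤-trans (≤-reflexive s≡) (s₂≤id n))) ≤N ∷
    ≤-trans (≤-trans (m≤m+n x _) x+2q≤n) ≤N ∷
    ≤-trans (≤-trans (m≤m+n q q) (≤-trans (m≤n+m (q + q) x) x+2q≤n)) ≤N ∷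
    z≤n ∷ z≤n ∷ z≤n ∷ [] , λ _ → z≤n
    where
    ≤N : n ≤ suc (n + n)
    ≤N = m≤n⇒m≤1+n (m≤m+n n n)
  Checkpoint⇒Bounded (searching srch v≤ _) =
    ≤N ∷ s≤s z≤n ∷ z≤n ∷ ≤-trans (s₂≤id n) ≤N ∷ ≤-trans (proj₂ node) ≤N ∷
    m≤n⇒m≤1+n (≤-trans h≤t t≤2n) ∷ m≤n⇒m≤1+n t≤2n ∷ ≤-trans e≤1+h (s≤s (≤-trans h≤t t≤2n)) ∷
    v≤ ∷ [] , word
    where
    open Searching srch
    ≤N : n ≤ suc (n + n)
    ≤N = m≤n⇒m≤1+n (m≤m+n n n)

  ¬Checkpoint-0 : ∀ {c} → ¬ Checkpoint 0 c
  ¬Checkpoint-0 (halving _ _ ())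
  ¬Checkpoint-0 (searching srch _ 4n<) =
    <⇒≱ 4n< (+-mono-≤ (≤-trans h≤t t≤2n) t≤2n)
    where open Searching srch

  -- The longest way from one checkpoint to the next, through the instructions
  -- 17–26 and 31–34, takes 14 steps.
  Progress′ : ℕ → Config 8 → Set
  Progress′ p = Progress program program-small (Sturdy n) 14 (Checkpoint p)

  -- A remainder of at least 2 loses a pair. Otherwise it is the next digit, and the quotient
  -- decides between another halving and the search.
  progress-halving : ∀ {p x q s} → 1 ≤ n → s + s₂ (x + (q + q)) ≡ s₂ n → x + (q + q) ≤ n →
                     (x + x + (q + q + q)) + suc (n + n) < suc p →
                     Progress′ p (at 2 s x q 0 0 0 (λ _ → 0))
  progress-halving {p} {zero} {zero} {s} 1≤n s≡ _ fuel =
    continuing 6 (m≤m+n 6 8)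
      (cong (λ s → at 17 s 1 n n 1 0 (λ _ → 0)) (trans (sym (+-identityʳ s)) s≡))
      (searching (initially n 1≤n) z≤n (+-monoˡ-< (n + n) (s≤s⁻¹ fuel)))
  progress-halving {p} {zero} {suc q} {s} 1≤n s≡ ≤n fuel =
    continuing 5 (m≤m+n 5 9) refl
      (halving (trans (cong (s +_) (trans (cong s₂ (+-identityʳ (suc q)))
                                          (sym (s₂-double (suc q)))))
                      s≡)
               (≤-trans (≤-trans (≤-reflexive (+-identityʳ (suc q))) (m≤m+n (suc q) (suc q))) ≤n)
               (<-≤-trans (+-monoˡ-< (suc (n + n)) shrink) (s≤s⁻¹ fuel)))
    where
    shrink : suc q + suc q + 0 < suc q + suc q + suc q
    shrink = +-monoʳ-< (suc q + suc q) (s≤s z≤n)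
  progress-halving {p} {suc zero} {zero} {s} 1≤n s≡ _ fuel =
    continuing 9 (m≤m+n 9 5)
      (cong (λ s → at 17 s 1 n n 1 0 (λ _ → 0))
        (trans (+-comm 1 s) (trans (cong (s +_) (sym (s₂-1+double 0))) s≡)))
      (searching (initially n 1≤n) z≤n
        (+-monoˡ-< (n + n) (≤-trans (s≤s (n≤1+n _)) (≤-trans (n≤1+n _) (s≤s⁻¹ fuel)))))
  progress-halving {p} {suc zero} {suc q} {s} 1≤n s≡ ≤n fuel =
    continuing 8 (m≤m+n 8 6) refl
      (halving (trans (sym (+-suc s _))
                      (trans (cong (s +_) (trans (cong (λ m → suc (s₂ m)) (+-identityʳ (suc q)))
                                                 (sym (s₂-1+double (suc q)))))
                             s≡))
               (≤-trans (≤-trans (≤-reflexive (+-identityʳ (suc q)))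
                                 (≤-trans (m≤m+n (suc q) (suc q)) (n≤1+n _))) ≤n)
               (<-≤-trans (+-monoˡ-< (suc (n + n)) shrink) (s≤s⁻¹ fuel)))
    where
    shrink : suc q + suc q + 0 < 2 + (suc q + suc q + suc q)
    shrink = ≤-trans (+-monoʳ-< (suc q + suc q) (s≤s z≤n)) (m≤n+m _ 2)
  progress-halving {p} {2+ x} {q} {s} 1≤n s≡ ≤n fuel =
    continuing 6 (m≤m+n 6 8) refl
      (halving (trans (cong (λ m → s + s₂ m) (moved x q)) s≡)
               (≤-trans (≤-reflexive (moved x q)) ≤n)
               (≤-trans (≤-reflexive (spent x q (suc (n + n)))) (s≤s⁻¹ fuel)))
    where
    moved : ∀ x q → x + (suc q + suc q) ≡ 2 + x + (q + q)
    moved = solve-∀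
    spent : ∀ x q c → suc (x + x + (suc q + suc q + suc q) + c) ≡ 2 + x + (2 + x) + (q + q + q) + c
    spent = solve-∀

  module _ {p y h t e v : ℕ} {μ : Memory} (srch : Searching n y h t e μ)
           (fuel : (n + n) + (n + n) < suc p + (h + t)) where

    open Searching srch
    open Block (s₂ n) y h t e v μ

    here : Config 8
    here = at 17 (s₂ n) y h t e v μ

    progress-visiting : μ y ≡ 0 → Progress′ p here
    progress-visiting μy≡0
      with k , k≤4 , reduced ← Block.reduction (s₂ n) (y + y) h (suc t) e 0
                                               ((μ [ y ↦ e ]) [ suc t ↦ y ]) =
      continuing (6 + k) (≤-trans (+-monoʳ-≤ 6 k≤4) (m≤m+n 10 4))
        (run-trans 6 k here (visiting μy≡0) reduced)
        (searching (visit n srch μy≡0)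
                   (≤-trans (m∸n≤m (y + y) n) (m≤n⇒m≤1+n (+-mono-≤ (proj₂ node) (proj₂ node))))
                   (≤-trans fuel (≤-reflexive (shift p h t))))
      where
      shift : ∀ p h t → suc p + (h + t) ≡ p + (h + suc t)
      shift = solve-∀

    module _ {w : ℕ} (μy≡ : μ y ≡ suc w) where

      open Found n srch (≤-trans (s≤s z≤n) (≤-reflexive (sym μy≡)))
        using (dequeue; 1+v≤2n; sturdy; flimsy)

      progress-dequeuing : ∀ {d} → t ∸ h ≡ suc d → Progress′ p here
      progress-dequeuing {d} t∸h≡
        with k , k≤4 , reduced ← Block.reduction (s₂ n) (suc (μ (suc h))) (suc h) t
                                                 (suc (μ (μ (suc h)))) (suc d) μ =
        continuing (10 + k) (+-monoʳ-≤ 10 k≤4)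
          (run-trans 10 k here (run-trans 3 7 here (tested μy≡) (dequeuing t∸h≡)) reduced)
          (searching (dequeue h<t)
                     (≤-trans (m∸n≤m (suc (μ (suc h))) n) (m≤n⇒m≤1+n (1+v≤2n h<t)))
                     (≤-trans fuel (≤-reflexive (sym (+-suc p (h + t))))))
        where
        h<t : h < t
        h<t = m∸n≢0⇒n<m λ z → 1+n≢0 (trans (sym t∸h≡) z)

      progress-answering : t ∸ h ≡ 0 → Progress′ p here
      progress-answering t∸h≡0 = halting 8 (m≤m+n 8 6)
        (run-trans 3 5 here (tested μy≡) (answering t∸h≡0 (s₂ n ∸ μ n) refl))
        (answer (s₂ n ∸ μ n) refl)
        where
        answer : ∀ w → s₂ n ∸ μ n ≡ w → Reflects (Sturdy n) (w ≡ᵇ 0)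
        answer zero    eq = ofʸ (sturdy (m∸n≡0⇒m≤n t∸h≡0) (m∸n≡0⇒m≤n eq))
        answer (suc w) eq = ofⁿ λ st → st (flimsy (m∸n≡0⇒m≤n t∸h≡0)
          (m∸n≢0⇒n<m λ z → 1+n≢0 (trans (sym eq) z)))

    progress-searching : Progress′ p here
    progress-searching = byLabel (μ y) refl
      where
      byQueue : ∀ {w} → μ y ≡ suc w → ∀ d → t ∸ h ≡ d → Progress′ p here
      byQueue μy≡ zero    t∸h≡ = progress-answering μy≡ t∸h≡
      byQueue μy≡ (suc d) t∸h≡ = progress-dequeuing μy≡ t∸h≡

      byLabel : ∀ w → μ y ≡ w → Progress′ p here
      byLabel zero    μy≡ = progress-visiting μy≡
      byLabel (suc w) μy≡ = byQueue μy≡ (t ∸ h) refl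

  progress : ∀ {p c} → 1 ≤ n → Checkpoint (suc p) c → Progress′ p c
  progress 1≤n (halving s≡ ≤n fuel)    = progress-halving 1≤n s≡ ≤n fuel
  progress 1≤n (searching srch _ fuel) = progress-searching srch fuel

  fuel₀ : ℕ
  fuel₀ = 2 + ((n + n) + (n + n))

  runs : 1 ≤ n → ∃[ k ] k ≤ 86 * n × Run program (Sturdy n) (2 ^ 14 * suc (n + n)) k (initial n)
  runs 1≤n =
    let m , m≤ , run = runFrom program program-small (s≤s z≤n) Checkpoint
                         Checkpoint⇒Bounded ¬Checkpoint-0 (progress 1≤n) fuel₀ start in
    2 + m , ≤-trans (s≤s (s≤s m≤)) (linear 1≤n) ,
    -- These are the two instructions before the first loop.
    prepend program program-small 2 (s≤s z≤n) start-Bounded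
      (*-monoˡ-≤ (suc (n + n)) (^-monoʳ-≤ 2 (m≤m+n 2 12))) run
    where
    enough : ∀ n → suc ((n + n + (0 + 0 + 0)) + suc (n + n)) ≡ 2 + ((n + n) + (n + n))
    enough = solve-∀

    start : Checkpoint fuel₀ (at 2 0 n 0 0 0 0 (λ _ → 0))
    start = halving {x = n} {q = 0} {s = 0} (cong s₂ (+-identityʳ n)) (≤-reflexive (+-identityʳ n))
                    (≤-reflexive (enough n))

    start-Bounded : Bounded (suc (n + n)) (initial {8} n)
    start-Bounded = m≤n⇒m≤1+n (m≤m+n n n) ∷ z≤n ∷ z≤n ∷ z≤n ∷ z≤n ∷ z≤n ∷ z≤n ∷ z≤n ∷ z≤n ∷ [] ,
                    λ _ → z≤n

    -- The left side is `56n + 30`, and `30 ≤ 30n`.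
    linear : ∀ {n} → 1 ≤ n → 2 + (2 + ((n + n) + (n + n))) * 14 ≤ 86 * n
    linear {suc n} _ = ≤-trans (m≤m+n _ (30 * n)) (≤-reflexive (expand n))
      where
      expand : ∀ n → 2 + (2 + ((suc n + suc n) + (suc n + suc n))) * 14 + 30 * n ≡ 86 * suc n
      expand = solve-∀

-- With `b` for `bitLength n`, `2n + 1` lies below `2 ^ (b + 1)`, and `K + b + 1 ≤ (2 + K) * b`
-- because `b` is positive. Stretches of 14 steps thus give the factor 16.
word-size : ∀ K n → 2 ^ K * suc (n + n) < 2 ^ ((2 + K) * bitLength n)
word-size K n = begin-strict
  2 ^ K * suc (n + n)                  <⟨ *-monoʳ-< (2 ^ K) {{m^n≢0 2 K}} (s≤s (≤-reflexive (sym (+-suc n n)))) ⟩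
  2 ^ K * (suc n + suc n)              ≤⟨ *-monoʳ-≤ (2 ^ K) (+-mono-≤ (n<2^bitLength n) (n<2^bitLength n)) ⟩
  2 ^ K * (2 ^ b + 2 ^ b)              ≡⟨ cong (λ m → 2 ^ K * (2 ^ b + m)) (+-identityʳ (2 ^ b)) ⟨
  2 ^ K * 2 ^ suc b                    ≡⟨ ^-distribˡ-+-* 2 K (suc b) ⟨
  2 ^ (K + suc b)                      ≤⟨ ^-monoʳ-≤ 2 (exponent K _) ⟩
  2 ^ ((2 + K) * b)                    ∎
  where
  open ≤-Reasoning
  b = bitLength n
  exponent : ∀ K l → K + suc (suc l) ≤ (2 + K) * suc l
  exponent K l = ≤-trans (m≤m+n _ (l + K * l)) (≤-reflexive (expand K l))
    where
    expand : ∀ K l → K + suc (suc l) + (l + K * l) ≡ (2 + K) * suc l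
    expand = solve-∀

theorem14 : ∃[ r ] Σ[ P ∈ Program r ] ∃[ C ] ∃[ c ]
    (∀ (n : ℕ) .{{_ : NonZero n}} →
    Decides P n (Sturdy n) (C * n) (c * bitLength n))
theorem14 = 8 , program , 86 , 16 , λ n →
  let k , k≤ , run = runs n (>-nonZero⁻¹ n) in Run⇒Decides program k≤ (word-size 14 n) run
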